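{- A tournament is unary FA-presentable if and only if it is isomorphic to one obtained by propagating a unary FA-foundational tournament (i.e. a unary FA-foundational binary relation $(Q,\rho)$ in which $(Q,\rho)$ is a tournament).
   Context: A tournament is a structure $(X,\rightarrow)$ with $\rightarrow$ a binary relation such that $x\not\rightarrow x$ for all $x$, and for all distinct $x,y$ exactly one of $x\rightarrow y$, $y\rightarrow x$ holds. A structure is unary FA-presentable if there exist a regular language $L\subseteq a^*$ and a surjection $\phi:L\to X$ such that for equality and for the relation, the set of pairs $(u,v)\in L^2$ whose images are related is regular (the set of words $\mathrm{conv}(u,v)$ over $\{a,\$\}^2$, reading both words in parallel with the shorter padded by $\$$, is a regular language). A unary FA-foundational binary relation is a finite set $Q$ with a relation $\rho$ and pairwise disjoint five-element subsets (seeds) $P_k=\{p^{(k)}_1,\dots,p^{(k)}_5\}$, $0\le k\le n-1$ ($n\ge0$), such that with $Q'=Q\setminus\bigcup_k P_k$, for all $k,l$ (possibly equal) and $q\in Q'$: (1) the statements $p^{(k)}_i\rho p^{(l)}_i$ ($1\le i\le5$) are all true or all false; (2) the statements $p^{(k)}_i\rho p^{(l)}_{i+1}$ ($1\le i\le4$) are all true or all false; (3) the statements $p^{(k)}_{i+1}\rho p^{(l)}_i$ ($1\le i\le 4$) are all true or all false; (4) the statements $p^{(k)}_i\rho p^{(l)}_j$ with $j-i\ge2$ are all true or all false; (5) the statements $p^{(k)}_j\rho p^{(l)}_i$ with $j-i\ge2$ are all true or all false; (6) the statements $q\rho p^{(k)}_i$ ($2\le i\le5$) are all true or all false; (7) the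 statements $p^{(k)}_i\rho q$ ($2\le i\le 5$) are all true or all false. Propagation yields $(\hat Q,\hat\rho)$ with $\hat Q=Q'\cup\{p^{(k)}_i:0\le k<n,\ i\in\mathbb{N}\}$ ($\mathbb{N}=\{1,2,\dots\}$, new elements for $i\ge6$) and: $\hat\rho=\rho$ on $Q'$; $p^{(k)}_i\hat\rho p^{(l)}_j$ iff [$j=i$ and $p^{(k)}_1\rho p^{(l)}_1$] or [$j=i+1$ and $p^{(k)}_1\rho p^{(l)}_2$] or [$j=i-1$ and $p^{(k)}_2\rho p^{(l)}_1$] or [$j\ge i+2$ and $p^{(k)}_1\rho p^{(l)}_3$] or [$j\le i-2$ and $p^{(k)}_3\rho p^{(l)}_1$]; for $q\in Q'$: $q\hat\rho p^{(k)}_1$ iff $q\rho p^{(k)}_1$, $q\hat\rho p^{(k)}_i$ ($i\ge2$) iff $q\rho p^{(k)}_2$, $p^{(k)}_1\hat\rho q$ iff $p^{(k)}_1\rho q$, $p^{(k)}_i\hat\rho q$ ($i\ge2$) iff $p^{(k)}_2\rho q$. -}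

module Defs where

open import Data.Fin using (Fin; zero; suc; inject₁; toℕ)
open import Data.Fin.Subset using (Subset; _∈_)
open import Data.List using (List; []; _∷_; foldl; map)
open import Data.Maybe using (Maybe; just; nothing)
open import Data.Nat as ℕ using (ℕ; zero; suc; _≤_)
open import Data.Product using (Σ; ∃; ∃₂; _×_; _,_)
open import Data.Refinement using (Refinement; Refinement-syntax; value)
open import Data.Sum using (_⊎_; inj₁; inj₂)
open import Data.Unit using (⊤)
open import Function.Bundles using (_⇔_; _↔_; _↠_; module Surjection)
open import Function.Definitions using (Injective)
open import Level using (Level; 0ℓ; _⊔_) renaming (suc to lsuc)
open import Relation.Binary.Core using (Rel)
open import Relation.Binary.Morphism.Structures using (IsOrderIsomorphism)
open import Relation.Binary.PropositionalEquality using (_≡_; _≢_)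
open import Relation.Nullary using (¬_)
open import Relation.Unary using (Pred)

private
  variable
    a b c ℓ ℓ₁ ℓ₂ : Level

record IsTournament {X : Set c} (_⟶_ : Rel X ℓ) : Set (c ⊔ ℓ) where
  field
    irreflexive : ∀ x → ¬ (x ⟶ x)
    exactlyOne  : ∀ x y → x ≢ y →
                  (x ⟶ y × ¬ (y ⟶ x)) ⊎ (¬ (x ⟶ y) × y ⟶ x)

-- The library's notion for ordered sets assumes nothing about the two
-- relations, so it is also isomorphism of arbitrary binary relations.
Isomorphic : {X : Set a} {Y : Set b} → Rel X ℓ₁ → Rel Y ℓ₂ → Set (a ⊔ b ⊔ ℓ₁ ⊔ ℓ₂)
Isomorphic {X = X} {Y = Y} _∼₁_ _∼₂_ =
  ∃ λ (f : X → Y) → IsOrderIsomorphism _≡_ _≡_ _∼₁_ _∼₂_ f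

Finite : Set a → Set a
Finite A = ∃ λ m → A ↔ Fin m

record DFA (A : Set a) : Set a where
  field
    states : ℕ
    start  : Fin states
    step   : Fin states → A → Fin states
    final  : Subset states

  Accepts : List A → Set
  Accepts w = foldl step start w ∈ final

Regular : {A : Set a} → Pred (List A) ℓ → Set (a ⊔ ℓ)
Regular {A = A} L = ∃ λ (M : DFA A) → ∀ w → L w ⇔ DFA.Accepts M w

-- `nothing` is the padding symbol $.
conv : {A : Set a} → List A → List A → List (Maybe A × Maybe A)
conv []       v        = map (λ y → nothing , just y) v
conv (x ∷ u)  []       = map (λ z → just z , nothing) (x ∷ u)
conv (x ∷ u)  (y ∷ v)  = (just x , just y) ∷ conv u v

-- The one-letter alphabet {a} is ⊤.  The domain of φ is a refinement
-- type so that φ depends only on the word, not on the proof that it is in L.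
record UnaryFAPresentable {X : Set c} (_⟶_ : Rel X ℓ) : Set (lsuc 0ℓ ⊔ c ⊔ ℓ) where
  field
    L         : Pred (List ⊤) 0ℓ
    L-regular : Regular L
    φ         : [ u ∈ List ⊤ ∣ L u ] ↠ X

  open Surjection φ using (to)

  Pairs : Rel X ℓ₁ → Pred (List (Maybe ⊤ × Maybe ⊤)) ℓ₁
  Pairs R w = ∃₂ λ u v → w ≡ conv (value u) (value v) × R (to u) (to v)

  field
    ≡-regular : Regular (Pairs _≡_)
    ⟶-regular : Regular (Pairs _⟶_)

AllOrNone : {I : Set a} → Pred I ℓ → Set (a ⊔ ℓ)
AllOrNone P = (∀ i → P i) ⊎ (∀ i → ¬ P i)

-- Indices within a seed start at 0 rather than 1: `p k i` is the element
-- p^(k)_{i+1} of the seed P_k.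
record FoundationalRelation : Set₁ where
  field
    Q        : Set
    Q-finite : Finite Q
    _ρ_      : Rel Q 0ℓ
    n        : ℕ
    p        : Fin n → Fin 5 → Q

    five-element : ∀ k → Injective _≡_ _≡_ (p k)
    disjoint     : ∀ k l → k ≢ l → ∀ i j → p k i ≢ p l j

  Q′ : Set
  Q′ = [ q ∈ Q ∣ (∀ k i → q ≢ p k i) ]

  Gap : Set
  Gap = Σ (Fin 5 × Fin 5) λ (i , j) → 2 ℕ.+ toℕ i ≤ toℕ j

  field
    cond₁ : ∀ k l → AllOrNone λ (i : Fin 5) → p k i ρ p l i
    cond₂ : ∀ k l → AllOrNone λ (i : Fin 4) → p k (inject₁ i) ρ p l (suc i)
    cond₃ : ∀ k l → AllOrNone λ (i : Fin 4) → p k (suc i) ρ p l (inject₁ i)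
    cond₄ : ∀ k l → AllOrNone λ (((i , j) , _) : Gap) → p k i ρ p l j
    cond₅ : ∀ k l → AllOrNone λ (((i , j) , _) : Gap) → p k j ρ p l i
    cond₆ : ∀ k (q : Q′) → AllOrNone λ (i : Fin 4) → value q ρ p k (suc i)
    cond₇ : ∀ k (q : Q′) → AllOrNone λ (i : Fin 4) → p k (suc i) ρ value q

module Propagation (F : FoundationalRelation) where
  open FoundationalRelation F

  private
    #1 #2 #3 : Fin 5
    #1 = zero
    #2 = suc zero
    #3 = suc (suc zero)

  -- `inj₂ (k , i)` is p^(k)_{i+1}; for i < 5 it stands for the seed element p k i.
  Q̂ : Set
  Q̂ = Q′ ⊎ (Fin n × ℕ)

  _ρ̂_ : Rel Q̂ 0ℓ
  inj₁ q ρ̂ inj₁ r = value q ρ value r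
  inj₂ (k , i) ρ̂ inj₂ (l , j) =
      (j ≡ i        × p k #1 ρ p l #1)
    ⊎ (j ≡ suc i    × p k #1 ρ p l #2)
    ⊎ (i ≡ suc j    × p k #2 ρ p l #1)
    ⊎ (2 ℕ.+ i ≤ j  × p k #1 ρ p l #3)
    ⊎ (2 ℕ.+ j ≤ i  × p k #3 ρ p l #1)
  inj₁ q ρ̂ inj₂ (k , zero)  = value q ρ p k #1
  inj₁ q ρ̂ inj₂ (k , suc _) = value q ρ p k #2
  inj₂ (k , zero)  ρ̂ inj₁ q = p k #1 ρ value q
  inj₂ (k , suc _) ρ̂ inj₁ q = p k #2 ρ value q

{-# OPTIONS --safe #-}
module Submission where

-- Words over {a} are natural numbers.  Iterating a letter on the states of a
-- DFA with at most K states is eventually periodic with period D = K!, so a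
-- regular relation on lengths is unchanged under (i , j) ↦ (i + D , j + D) for
-- i , j ≥ D, and under moving the larger argument by D once the two are at
-- least D apart; conversely, any decidable relation with these two properties
-- is regular.
--
-- From a presentation, the least representatives of the elements form a set
-- that is D-periodic from 3D on.  Those below 3D become Q′, and each
-- representative in [3D , 4D) becomes the first element of a seed, whose later
-- elements are its translates by multiples of D.  Conversely, words are
-- cut into blocks with one residue per element of Q: in block i, the residue
-- of an element of the seed k represents p^(k)_{i+1}, and the residue of q ∈ Q′
-- represents q in every block.

open import Defs
open import Data.Bool using (T; true)
open import Data.Bool.Properties using (T?)
open import Data.Empty using (⊥; ⊥-elim-irr)
open import Data.Fin as Fin using (Fin; combine; fromℕ<; remQuot; suc; toℕ; zero)
open import Data.Fin.Patterns using (0F; 1F; 2F)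
open import Data.Fin.Properties as Fin using (*↔×; +↔⊎; any?; pigeonhole; remQuot-combine; toℕ-fromℕ<; toℕ-injective; toℕ-inject₁; toℕ<n)
open import Data.Fin.Subset using (Subset; _∈_)
open import Data.Fin.Subset.Properties using (_∈?_)
open import Data.Irrelevant using ([_])
open import Data.List using (List; []; _∷_; foldl; length; map; mapMaybe; replicate)
open import Data.List.Properties using (length-replicate; map-id)
open import Data.Maybe as Maybe using (Maybe; is-just; just; nothing)
open import Data.Nat using (>-nonZero⁻¹; NonZero; _!; _*_; _+_; _<?_; _<_; _∸_; _≟_; _≤?_; _≤_; suc; s≤s; s≤s⁻¹; zero; z≤n; ℕ)
open import Data.Nat.DivMod using (+-distrib-/-∣ʳ; /-monoˡ-≤; [m+kn]%n≡m%n; [m+n]%n≡m%n; _%_; _/_; _mod_; m%n<n; m*n/n≡m; m<n⇒m%n≡m; m<n⇒m/n≡0; m≡m%n+[m/n]*n; m≥n⇒m/n>0; n/n≡1)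
open import Data.Nat.Divisibility using (_∣_; divides; divides-refl; m∣m*n; m≤n⇒m!∣n!; ∣-refl; ∣-trans)
open import Data.Nat.GeneralisedArithmetic using (fold; fold-+)
open import Data.Nat.Induction using (<-rec)
open import Data.Nat.Properties
open import Algebra.Properties.CommutativeSemigroup +-commutativeSemigroup using (xy∙z≈xz∙y)
open import Data.Product as Product using (_,_; _×_; map₂; proj₁; proj₂; Σ; ∃; ∃₂)
import Data.Product.Properties as Product
open import Data.Refinement as Refinement using (Refinement; _,_; value; value-injective)
open import Data.Sum as Sum using (_⊎_; inj₁; inj₂)
open import Data.Sum.Function.Propositional using (_⊎-↔_)
open import Data.Sum.Properties as Sum using (inj₁-injective; inj₂-injective)
open import Data.Unit using (tt; ⊤)
open import Data.Vec using (tabulate)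
open import Data.Vec.Properties using ([]=⇒lookup; lookup⇒[]=; lookup∘tabulate)
open import Function.Base using (_∘_; id)
open import Function.Bundles using (_⇔_; mk↠ₛ; mk⇔; module Equivalence; module Inverse; module Surjection)
open import Function.Construct.Composition using (_↔-∘_; _⇔-∘_)
open import Function.Construct.Identity using (↔-id; ⇔-id)
open import Function.Construct.Symmetry using (↔-sym; ⇔-sym)
open import Function.Definitions using (Injective; StrictlySurjective)
open import Function.Properties.Inverse using (↔⇒↣)
open import Level using (0ℓ; Level)
open import Relation.Binary.Core using (Rel)
open import Relation.Binary.Definitions as B using (DecidableEquality; tri<; tri>; tri≈)
open import Relation.Binary.Morphism.Structures using (IsOrderIsomorphism)
open import Relation.Binary.PropositionalEquality hiding ([_])
open import Relation.Nullary using (Dec; _×-dec_; _⊎-dec_; contradiction; does; no; recompute; yes; ¬?; ¬_)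
open import Relation.Nullary.Decidable using (dec-true)
open import Relation.Unary using (Decidable; Pred)

open Equivalence using (to; from)

private
  variable
    a b c ℓ ℓ₁ ℓ₂ : Level

infixr 8 _⨾_
_⨾_ : {A : Set a} {B : Set b} {C : Set c} → A ⇔ B → B ⇔ C → A ⇔ C
A⇔B ⨾ B⇔C = B⇔C ⇔-∘ A⇔B

subst-⇔ : {A : Set a} (P : Pred A ℓ₁) {x y : A} → x ≡ y → P x ⇔ P y
subst-⇔ P refl = ⇔-id _

subst₂-⇔ : {A B : Set a} (R : A → B → Set ℓ₁) {x x′ : A} {y y′ : B} →
           x ≡ x′ → y ≡ y′ → R x y ⇔ R x′ y′
subst₂-⇔ R refl refl = ⇔-id _

-- Eventually periodic predicates and relations

Periodic : ℕ → ℕ → Pred ℕ ℓ₁ → Set ℓ₁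
Periodic N D P = ∀ n → N ≤ n → P n ⇔ P (n + D)

Periodic-suc : ∀ {N D} {P : Pred ℕ ℓ₁} → Periodic N D P → Periodic N D (P ∘ suc)
Periodic-suc per n N≤n = per (suc n) (m≤n⇒m≤1+n N≤n)

record PeriodicRel (N D : ℕ) (S : Rel ℕ ℓ₁) : Set ℓ₁ where
  field
    diagonal : ∀ i j → N ≤ i → N ≤ j → S i j ⇔ S (i + D) (j + D)
    rightFar : ∀ i j → i + N ≤ j → S i j ⇔ S i (j + D)
    leftFar  : ∀ i j → j + N ≤ i → S i j ⇔ S (i + D) j

-- Automata counting modulo an eventual period

module Counter (N D : ℕ) .{{_ : NonZero D}} where

  Count : Set
  Count = Fin (N + D)

  -- The successor of the last state `N + D - 1`: going back to `N` gives a tail of `N` states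
  -- followed by a loop of `D`.
  wrap : Count
  wrap = fromℕ< (m<m+n N (>-nonZero⁻¹ D))

  origin : Count
  origin = fromℕ< (≤-trans (>-nonZero⁻¹ D) (m≤n+m D N))

  next : Count → Count
  next c with suc (toℕ c) <? N + D
  ... | yes c+1<K = fromℕ< c+1<K
  ... | no  _     = wrap

  count : ℕ → Count
  count zero    = origin
  count (suc n) = next (count n)

  next-periodic : {P : Pred ℕ ℓ₁} → Periodic N D P → ∀ c → P (suc (toℕ c)) ⇔ P (toℕ (next c))
  next-periodic {P = P} per c with suc (toℕ c) <? N + D
  ... | yes c+1<K = subst-⇔ P (sym (toℕ-fromℕ< c+1<K))
  -- Here `suc (toℕ c)` is exactly `N + D`, which periodicity at `N` exchanges for `N`.
  ... | no  c+1≮K =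
    subst-⇔ P (≤-antisym (toℕ<n c) (≮⇒≥ c+1≮K)) ⨾ ⇔-sym (per N ≤-refl) ⨾
    subst-⇔ P (sym (toℕ-fromℕ< (m<m+n N (>-nonZero⁻¹ D))))

  -- The predicate varies in the induction: the hypothesis is used for `P ∘ suc`, and the last
  -- letter becomes one application of `next`.
  count-periodic : {P : Pred ℕ ℓ₁} → Periodic N D P → ∀ n → P n ⇔ P (toℕ (count n))
  count-periodic {P = P} per zero    = subst-⇔ P (sym (toℕ-fromℕ< (≤-trans (>-nonZero⁻¹ D) (m≤n+m D N))))
  count-periodic         per (suc n) =
    count-periodic (Periodic-suc per) n ⨾ next-periodic per (count n)

finals : ∀ {m} {P : Pred (Fin m) ℓ₁} → Decidable P → Subset m
finals P? = tabulate (does ∘ P?)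

∈-finals : ∀ {m} {P : Pred (Fin m) ℓ₁} (P? : Decidable P) s → P s ⇔ s ∈ finals P?
∈-finals P? s = mk⇔
  (λ Ps → lookup⇒[]= s _ (trans (lookup∘tabulate _ s) (dec-true (P? s) Ps)))
  (λ s∈ → witness (P? s) (trans (sym (lookup∘tabulate _ s)) ([]=⇒lookup s∈)))
  where
  witness : {A : Set ℓ₁} (A? : Dec A) → does A? ≡ true → A
  witness (yes x) _ = x

a^_ : ℕ → List ⊤
a^ n = replicate n tt

periodic⇒regular : ∀ N D .{{_ : NonZero D}} {P : Pred ℕ ℓ₁} → Decidable P → Periodic N D P →
                   Regular (P ∘ length {A = ⊤})
periodic⇒regular N D {P} P? per = M , λ u →
  count-periodic per (length u) ⨾
  subst-⇔ (P ∘ toℕ) (sym (trans (run 0 u) (cong count (+-identityʳ (length u))))) ⨾ ∈-finals P?′ _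
  where
  open Counter N D
  P?′ : Decidable (P ∘ toℕ {N + D})
  P?′ = P? ∘ toℕ
  M : DFA ⊤
  M = record { states = N + D ; start = origin ; step = λ c _ → next c ; final = finals P?′ }
  run : ∀ k u → foldl (DFA.step M) (count k) u ≡ count (length u + k)
  run k []      = refl
  run k (_ ∷ u) = trans (run (suc k) u) (cong count (+-suc (length u) k))

-- Automata reading two words in parallel

Letter : Set
Letter = Maybe ⊤ × Maybe ⊤

ConvLanguage : Rel ℕ ℓ₁ → Pred (List Letter) ℓ₁
ConvLanguage S w = ∃₂ λ i j → w ≡ conv (a^ i) (a^ j) × S i j

-- A configuration (phase , i , d) records that i letters (a , a) have been
-- read, followed by d letters (a , $) in phase 1 and d letters ($ , a) in
-- phase 2; d is 0 in phase 0.
Config : Set → Set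
Config C = Maybe (Fin 3 × C × C)

module _ {C : Set} (next : C → C) where

  -- The counter is a parameter: with `suc` on ℕ a run records exact lengths, with `next` on the
  -- states of a `Counter` it is a finite automaton. A letter out of the order of a convolution
  -- leads to the dead configuration `nothing`.
  stepConfig : Config C → Letter → Config C
  stepConfig (just (0F , i , d)) (just _  , just _ ) = just (0F , next i , d)
  stepConfig (just (0F , i , d)) (just _  , nothing) = just (1F , i , next d)
  stepConfig (just (0F , i , d)) (nothing , just _ ) = just (2F , i , next d)
  stepConfig (just (1F , i , d)) (just _  , nothing) = just (1F , i , next d)
  stepConfig (just (2F , i , d)) (nothing , just _ ) = just (2F , i , next d)
  stepConfig _                   _                   = nothing

mapConfig : {B C : Set} → (B → C) → Config B → Config C
mapConfig f (just (ph , i , d)) = just (ph , f i , f d)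
mapConfig f nothing             = nothing

-- Allows a run with exact counts to be simulated by one with finitely many counts; in its use `f`
-- is `count`.
mapConfig-step : {B C : Set} {f : B → C} {next : B → B} {next′ : C → C} →
                 (∀ b → f (next b) ≡ next′ (f b)) → ∀ c x →
                 mapConfig f (stepConfig next c x) ≡ stepConfig next′ (mapConfig f c) x
mapConfig-step hom nothing             _                   = refl
mapConfig-step hom (just (0F , i , d)) (just _  , just _ ) = cong (λ i′ → just (0F , i′ , _)) (hom i)
mapConfig-step hom (just (0F , i , d)) (just _  , nothing) = cong (λ d′ → just (1F , _ , d′)) (hom d)
mapConfig-step hom (just (0F , i , d)) (nothing , just _ ) = cong (λ d′ → just (2F , _ , d′)) (hom d)
mapConfig-step hom (just (0F , i , d)) (nothing , nothing) = refl
mapConfig-step hom (just (1F , i , d)) (just _  , just _ ) = refl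
mapConfig-step hom (just (1F , i , d)) (just _  , nothing) = cong (λ d′ → just (1F , _ , d′)) (hom d)
mapConfig-step hom (just (1F , i , d)) (nothing , _      ) = refl
mapConfig-step hom (just (2F , i , d)) (just _  , _      ) = refl
mapConfig-step hom (just (2F , i , d)) (nothing , just _ ) = cong (λ d′ → just (2F , _ , d′)) (hom d)
mapConfig-step hom (just (2F , i , d)) (nothing , nothing) = refl

encode : ∀ {K} → Config (Fin K) → Fin (suc (3 * (K * K)))
encode nothing             = zero
encode (just (ph , i , d)) = suc (combine ph (combine i d))

decode : ∀ {K} → Fin (suc (3 * (K * K))) → Config (Fin K)
decode         zero    = nothing
decode {K = K} (suc x) = just (map₂ (remQuot {K} K) (remQuot {3} (K * K) x))

decode-encode : ∀ {K} (c : Config (Fin K)) → decode (encode c) ≡ c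
decode-encode nothing = refl
decode-encode {K = K} (just (ph , i , d)) = cong just (trans
  (cong (map₂ (remQuot {K} K)) (remQuot-combine ph (combine i d)))
  (cong (ph ,_) (remQuot-combine i d)))

module _ (S : Rel ℕ ℓ₁) where

  -- In phase 0, where runs keep `d` at 0, `S (i + d) i` amounts to `S i i`; the longer form lets
  -- phases 0 and 1 share one periodicity argument.
  Accepting : Config ℕ → Set ℓ₁
  Accepting (just (0F , i , d)) = S (i + d) i
  Accepting (just (1F , i , d)) = S (i + d) i
  Accepting (just (2F , i , d)) = S i (i + d)
  Accepting nothing             = Level.Lift _ ⊥

  private
    run : Config ℕ → List Letter → Config ℕ
    run = foldl (stepConfig suc)

  run-nothing : ∀ w → run nothing w ≡ nothing
  run-nothing []      = refl
  run-nothing (x ∷ w) = run-nothing w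

  run-left : ∀ i d e → run (just (1F , i , d)) (map (λ z → just z , nothing) (a^ e)) ≡ just (1F , i , e + d)
  run-left i d zero    = refl
  run-left i d (suc e) = trans (run-left i (suc d) e) (cong (λ z → just (1F , i , z)) (+-suc e d))

  run-right : ∀ i d e → run (just (2F , i , d)) (map (λ z → nothing , just z) (a^ e)) ≡ just (2F , i , e + d)
  run-right i d zero    = refl
  run-right i d (suc e) = trans (run-right i (suc d) e) (cong (λ z → just (2F , i , z)) (+-suc e d))

  rejects : ∀ w → Accepting (run nothing w) → ⊥
  rejects w acc with subst Accepting (run-nothing w) acc
  ... | Level.lift ()

  accepted-left : ∀ i d w → Accepting (run (just (1F , i , d)) w) →
                  ∃ λ e → w ≡ map (λ z → just z , nothing) (a^ e) × S (i + (e + d)) i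
  accepted-left i d []                       acc = 0 , refl , acc
  accepted-left i d ((just _ , nothing) ∷ w) acc with accepted-left i (suc d) w acc
  ... | e , eq , s = suc e , cong (_ ∷_) eq , subst (λ z → S (i + z) i) (+-suc e d) s
  accepted-left i d ((just _ , just _)  ∷ w) acc = contradiction acc (rejects w)
  accepted-left i d ((nothing , _)      ∷ w) acc = contradiction acc (rejects w)

  accepted-right : ∀ i d w → Accepting (run (just (2F , i , d)) w) →
                   ∃ λ e → w ≡ map (λ z → nothing , just z) (a^ e) × S i (i + (e + d))
  accepted-right i d []                       acc = 0 , refl , acc
  accepted-right i d ((nothing , just _) ∷ w) acc with accepted-right i (suc d) w acc
  ... | e , eq , s = suc e , cong (_ ∷_) eq , subst (λ z → S i (i + z)) (+-suc e d) s
  accepted-right i d ((nothing , nothing) ∷ w) acc = contradiction acc (rejects w)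
  accepted-right i d ((just _  , _)       ∷ w) acc = contradiction acc (rejects w)

  -- Induction on the word, with `k` letters (a , a) already read. The first padded letter settles
  -- which word is shorter, and the rest must be padding on the same side.
  accepted : ∀ k w → Accepting (run (just (0F , k , 0)) w) →
             ∃₂ λ i j → w ≡ conv (a^ i) (a^ j) × S (k + i) (k + j)
  accepted k [] acc = 0 , 0 , refl , subst (λ z → S (k + 0) z) (sym (+-identityʳ k)) acc
  accepted k ((just _ , just _) ∷ w) acc with accepted (suc k) w acc
  ... | i , j , eq , s = suc i , suc j , cong (_ ∷_) eq , subst₂ S (sym (+-suc k i)) (sym (+-suc k j)) s
  accepted k ((just _ , nothing) ∷ w) acc with accepted-left k 1 w acc
  ... | e , eq , s = suc e , 0 , cong (_ ∷_) eq ,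
    subst₂ S (cong (k +_) (+-comm e 1)) (sym (+-identityʳ k)) s
  accepted k ((nothing , just _) ∷ w) acc with accepted-right k 1 w acc
  ... | e , eq , s = 0 , suc e , cong (_ ∷_) eq ,
    subst₂ S (sym (+-identityʳ k)) (cong (k +_) (+-comm e 1)) s
  accepted k ((nothing , nothing) ∷ w) acc = contradiction acc (rejects w)

  run-conv : ∀ k i j → S (k + i) (k + j) → Accepting (run (just (0F , k , 0)) (conv (a^ i) (a^ j)))
  run-conv k zero    zero    s = subst (S (k + 0)) (+-identityʳ k) s
  run-conv k zero    (suc j) s rewrite run-right k 1 j =
    subst₂ S (+-identityʳ k) (cong (k +_) (+-comm 1 j)) s
  run-conv k (suc i) zero    s rewrite run-left k 1 i =
    subst₂ S (cong (k +_) (+-comm 1 i)) (+-identityʳ k) s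
  run-conv k (suc i) (suc j) s = run-conv (suc k) i j (subst₂ S (+-suc k i) (+-suc k j) s)

  conv⇔accepting : ∀ w → ConvLanguage S w ⇔ Accepting (run (just (0F , 0 , 0)) w)
  conv⇔accepting w = mk⇔ (λ { (i , j , refl , s) → run-conv 0 i j s }) (accepted 0 w)

  module _ (S? : ∀ i j → Dec (S i j)) where

    accepting? : Decidable Accepting
    accepting? (just (0F , i , d)) = S? (i + d) i
    accepting? (just (1F , i , d)) = S? (i + d) i
    accepting? (just (2F , i , d)) = S? i (i + d)
    accepting? nothing             = no λ ()

  module _ {N D : ℕ} (per : PeriodicRel N D S) where
    open PeriodicRel per

    -- Periodicity far from the diagonal governs the difference `d` for fixed `i`, periodicity along
    -- the diagonal governs `i` for fixed `d`. The two counters can therefore be reduced one after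
    -- the other.
    left-periodicʳ : ∀ i → Periodic N D (λ d → S (i + d) i)
    left-periodicʳ i d N≤d =
      leftFar (i + d) i (+-monoʳ-≤ i N≤d) ⨾ subst-⇔ (λ z → S z i) (+-assoc i d D)

    right-periodicʳ : ∀ i → Periodic N D (λ d → S i (i + d))
    right-periodicʳ i d N≤d =
      rightFar i (i + d) (+-monoʳ-≤ i N≤d) ⨾ subst-⇔ (S i) (+-assoc i d D)

    left-periodicˡ : ∀ d → Periodic N D (λ i → S (i + d) i)
    left-periodicˡ d i N≤i =
      diagonal (i + d) i (≤-trans N≤i (m≤m+n i d)) N≤i ⨾
      subst-⇔ (λ z → S z (i + D)) (xy∙z≈xz∙y i d D)

    right-periodicˡ : ∀ d → Periodic N D (λ i → S i (i + d))
    right-periodicˡ d i N≤i =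
      diagonal i (i + d) N≤i (≤-trans N≤i (m≤m+n i d)) ⨾
      subst-⇔ (S (i + D)) (xy∙z≈xz∙y i d D)

    module _ .{{_ : NonZero D}} where
      open Counter N D

      accepting-count : ∀ c → Accepting c ⇔ Accepting (mapConfig (toℕ ∘ count) c)
      accepting-count nothing = ⇔-id _
      accepting-count (just (0F , i , d)) =
        count-periodic (left-periodicʳ i) d ⨾ count-periodic (left-periodicˡ _) i
      accepting-count (just (1F , i , d)) =
        count-periodic (left-periodicʳ i) d ⨾ count-periodic (left-periodicˡ _) i
      accepting-count (just (2F , i , d)) =
        count-periodic (right-periodicʳ i) d ⨾ count-periodic (right-periodicˡ _) i

-- The automaton follows the exact configuration with both counters reduced modulo the eventual
-- period; by `accepting-count` the reduction does not affect acceptance.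
periodicRel⇒regular : ∀ N D .{{_ : NonZero D}} {S : Rel ℕ ℓ₁} → (∀ i j → Dec (S i j)) →
                      PeriodicRel N D S → Regular (ConvLanguage S)
periodicRel⇒regular N D {S} S? per = M , λ w →
  conv⇔accepting S w ⨾ accepting-count S per (run∞ w) ⨾
  subst-⇔ (Accepting S) (mapConfig-∘ (run∞ w)) ⨾
  subst-⇔ (Accepting S ∘ mapConfig toℕ) (sym (run (just (0F , 0 , 0)) w)) ⨾ ∈-finals final? _
  where
  open Counter N D
  final? : Decidable (Accepting S ∘ mapConfig toℕ ∘ decode {N + D})
  final? s = accepting? S S? (mapConfig toℕ (decode {N + D} s))
  M : DFA Letter
  M = record
    { states = suc (3 * ((N + D) * (N + D)))
    ; start  = encode (just (0F , origin , origin))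
    ; step   = λ s x → encode (stepConfig next (decode {N + D} s) x)
    ; final  = finals final?
    }
  run∞ : List Letter → Config ℕ
  run∞ = foldl (stepConfig suc) (just (0F , 0 , 0))
  mapConfig-∘ : ∀ c → mapConfig (toℕ ∘ count) c ≡ mapConfig toℕ (mapConfig count c)
  mapConfig-∘ nothing  = refl
  mapConfig-∘ (just _) = refl
  run : ∀ c w → decode (foldl (DFA.step M) (encode (mapConfig count c)) w) ≡
                mapConfig count (foldl (stepConfig suc) c w)
  run c []      = decode-encode _
  run c (x ∷ w) = trans
    (cong (λ c′ → decode (foldl (DFA.step M) c′ w))
      (cong encode (trans (cong (λ c′ → stepConfig next c′ x) (decode-encode _))
        (sym (mapConfig-step (λ _ → refl) c x)))))
    (run (stepConfig suc c x) w)

-- Periods of automata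

fold-comm : {A : Set a} (z : A) (f : A → A) → ∀ n → fold (f z) f n ≡ f (fold z f n)
fold-comm z f zero    = refl
fold-comm z f (suc n) = cong f (fold-comm z f n)

module _ {A : Set a} {z : A} {f : A → A} where

  -- Later iterates depend only on the repeated value, so one repetition propagates.
  fold-period : ∀ {i} q → fold z f (q + i) ≡ fold z f i → ∀ {t} → i ≤ t → fold z f (q + t) ≡ fold z f t
  fold-period {i} q eq i≤t with s , refl ← m≤n⇒∃[o]m+o≡n i≤t = begin
    fold z f (q + (i + s))      ≡⟨ cong (fold z f) (trans (sym (+-assoc q i s)) (+-comm (q + i) s)) ⟩
    fold z f (s + (q + i))      ≡⟨ fold-+ z f s ⟩
    fold (fold z f (q + i)) f s ≡⟨ cong (λ y → fold y f s) eq ⟩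
    fold (fold z f i) f s       ≡⟨ fold-+ z f s ⟨
    fold z f (s + i)            ≡⟨ cong (fold z f) (+-comm s i) ⟩
    fold z f (i + s)            ∎
    where open ≡-Reasoning

  fold-multiple : ∀ {i q} → (∀ {t} → i ≤ t → fold z f (q + t) ≡ fold z f t) →
                  ∀ k {t} → i ≤ t → fold z f (k * q + t) ≡ fold z f t
  fold-multiple         per zero    i≤t = refl
  fold-multiple {q = q} per (suc k) {t} i≤t = trans
    (cong (fold z f) (+-assoc q (k * q) t))
    (trans (per (≤-trans i≤t (m≤n+m t (k * q)))) (fold-multiple per k i≤t))

m∣n! : ∀ {m n} → 0 < m → m ≤ n → m ∣ n !
m∣n! {suc m} _ m<n = ∣-trans (m∣m*n (m !)) (m≤n⇒m!∣n! m<n)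

n≤n! : ∀ n → n ≤ n !
n≤n! zero    = z≤n
n≤n! (suc n) = m≤m*n (suc n) (n !) {{n !≢0}}

-- Two of the first `m + 1` iterates coincide. Their distance is at most `K` and so divides `K !`,
-- and the first of them has index at most `K ≤ K !`, where the repetition has already begun.
fold-periodic : ∀ {m K} (f : Fin m → Fin m) → m ≤ K → ∀ z {t} → K ! ≤ t → fold z f t ≡ fold z f (t + K !)
fold-periodic {m} {K} f m≤K z {t} K!≤t
  with i , j , i<j , eq ← pigeonhole ≤-refl (λ (i : Fin (suc m)) → fold z f (toℕ i))
  with divides k K!≡kq ← m∣n! {n = K} (m<n⇒0<n∸m i<j)
                           (≤-trans (m∸n≤m (toℕ j) (toℕ i)) (≤-trans (s≤s⁻¹ (toℕ<n j)) m≤K))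
  = sym (trans (cong (fold z f) (trans (+-comm t (K !)) (cong (_+ t) K!≡kq)))
    (fold-multiple {i = toℕ i} (fold-period (toℕ j ∸ toℕ i) (trans (cong (fold z f) (m∸n+n≡m (<⇒≤ i<j))) (sym eq))) k
      (≤-trans (≤-trans (s≤s⁻¹ (toℕ<n i)) m≤K) (≤-trans (n≤n! K) K!≤t))))

foldl-map-a^ : {A : Set a} {B : Set b} (step : B → A → B) (g : ⊤ → A) → ∀ s n →
               foldl step s (map g (a^ n)) ≡ fold s (λ s′ → step s′ (g tt)) n
foldl-map-a^ step g s zero    = refl
foldl-map-a^ step g s (suc n) = trans (foldl-map-a^ step g (step s (g tt)) n) (fold-comm s _ n)

conv-[] : {A : Set a} (u : List A) → conv u [] ≡ map (λ z → just z , nothing) u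
conv-[] []      = refl
conv-[] (x ∷ u) = refl

module _ {B : Set b} (step : B → Letter → B) where

  private
    both leftOnly rightOnly : B → B
    both      s = step s (just tt , just tt)
    leftOnly  s = step s (just tt , nothing)
    rightOnly s = step s (nothing , just tt)

  foldl-conv-right : ∀ s i d → foldl step s (conv (a^ i) (a^ (i + d))) ≡ fold (fold s both i) rightOnly d
  foldl-conv-right s zero    d = foldl-map-a^ step _ s d
  foldl-conv-right s (suc i) d = trans (foldl-conv-right (both s) i d)
    (cong (λ z → fold z rightOnly d) (fold-comm s both i))

  foldl-conv-left : ∀ s i d → foldl step s (conv (a^ (i + d)) (a^ i)) ≡ fold (fold s both i) leftOnly d
  foldl-conv-left s zero    d = trans (cong (foldl step s) (conv-[] (a^ d))) (foldl-map-a^ step _ s d)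
  foldl-conv-left s (suc i) d = trans (foldl-conv-left (both s) i d)
    (cong (λ z → fold z leftOnly d) (fold-comm s both i))

accepts-periodic : ∀ (M : DFA ⊤) {K} → DFA.states M ≤ K → Periodic (K !) (K !) (λ n → DFA.Accepts M (a^ n))
accepts-periodic M {K} m≤K n K!≤n = subst-⇔ (_∈ final) (trans (run n)
  (trans (fold-periodic (λ s → step s tt) m≤K start K!≤n) (sym (run (n + K !)))))
  where
  open DFA M
  run : ∀ n → foldl step start (a^ n) ≡ fold start (λ s → step s tt) n
  run n = trans (cong (foldl step start) (sym (map-id (a^ n)))) (foldl-map-a^ step id start n)

-- A run on a convolution iterates the letter (a , a) and then one padded letter. The diagonal shift
-- lengthens the first iteration by `K !`, the far shifts lengthen the second.
accepts-conv-periodic : ∀ (M : DFA Letter) {K} → DFA.states M ≤ K →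
                        PeriodicRel (K !) (K !) (λ i j → DFA.Accepts M (conv (a^ i) (a^ j)))
accepts-conv-periodic M {K} m≤K = record
  { diagonal = diagonal
  ; rightFar = rightFar
  ; leftFar  = leftFar
  }
  where
  open DFA M
  D : ℕ
  D = K !
  S : Rel ℕ 0ℓ
  S i j = Accepts (conv (a^ i) (a^ j))
  per : ∀ x z {t} → D ≤ t → fold z (λ s → step s x) t ≡ fold z (λ s → step s x) (t + D)
  per x = fold-periodic (λ s → step s x) m≤K
  diagonal : ∀ i j → D ≤ i → D ≤ j → S i j ⇔ S (i + D) (j + D)
  diagonal i j D≤i D≤j with ≤-total i j
  ... | inj₁ i≤j with d , refl ← m≤n⇒∃[o]m+o≡n i≤j =
    subst-⇔ (_∈ final) (trans (foldl-conv-right step start i d)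
      (trans (cong (λ z → fold z _ d) (per _ start D≤i)) (sym (foldl-conv-right step start (i + D) d)))) ⨾
    subst-⇔ (S (i + D)) (xy∙z≈xz∙y i D d)
  ... | inj₂ j≤i with d , refl ← m≤n⇒∃[o]m+o≡n j≤i =
    subst-⇔ (_∈ final) (trans (foldl-conv-left step start j d)
      (trans (cong (λ z → fold z _ d) (per _ start D≤j)) (sym (foldl-conv-left step start (j + D) d)))) ⨾
    subst-⇔ (λ z → S z (j + D)) (xy∙z≈xz∙y j D d)
  rightFar : ∀ i j → i + D ≤ j → S i j ⇔ S i (j + D)
  rightFar i j i+D≤j with d , refl ← m≤n⇒∃[o]m+o≡n (≤-trans (m≤m+n i D) i+D≤j) =
    subst-⇔ (_∈ final) (trans (foldl-conv-right step start i d)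
      (trans (per _ _ (+-cancelˡ-≤ i D d i+D≤j)) (sym (foldl-conv-right step start i (d + D))))) ⨾
    subst-⇔ (S i) (sym (+-assoc i d D))
  leftFar : ∀ i j → j + D ≤ i → S i j ⇔ S (i + D) j
  leftFar i j j+D≤i with d , refl ← m≤n⇒∃[o]m+o≡n (≤-trans (m≤m+n j D) j+D≤i) =
    subst-⇔ (_∈ final) (trans (foldl-conv-left step start j d)
      (trans (per _ _ (+-cancelˡ-≤ j D d j+D≤i)) (sym (foldl-conv-left step start j (d + D))))) ⨾
    subst-⇔ (λ z → S z j) (sym (+-assoc j d D))

-- Enumeration of a decidable predicate below a bound

record Enumeration (P : Pred ℕ ℓ₁) (B : ℕ) : Set ℓ₁ where
  field
    size        : ℕ
    nth         : Fin size → ℕ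
    nth<        : ∀ x → nth x < B
    nth-P       : ∀ x → P (nth x)
    injective   : Injective _≡_ _≡_ nth
    index       : ∀ {i} → i < B → P i → ∃ λ x → nth x ≡ i

enumerate : {P : Pred ℕ ℓ₁} → Decidable P → ∀ B → Enumeration P B
enumerate P? zero = record
  { size = 0 ; nth = λ () ; nth< = λ () ; nth-P = λ () ; injective = λ { {()} } ; index = λ () }
enumerate {P = P} P? (suc B) with enumerate P? B | P? B
... | rec | no ¬PB = record
  { Enumeration rec
  ; nth<  = m≤n⇒m≤1+n ∘ nth<
  ; index = index′
  }
  where
  open Enumeration rec
  index′ : ∀ {i} → i < suc B → P i → ∃ λ x → nth x ≡ i
  index′ i<1+B Pi with m<1+n⇒m<n∨m≡n i<1+B
  ... | inj₁ i<B  = index i<B Pi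
  ... | inj₂ refl = contradiction Pi ¬PB
... | rec | yes PB = record
  { size      = suc size
  ; nth       = nth′
  ; nth<      = λ { zero → ≤-refl ; (suc x) → m≤n⇒m≤1+n (nth< x) }
  ; nth-P     = λ { zero → PB ; (suc x) → nth-P x }
  ; injective = injective′
  ; index     = index′
  }
  where
  open Enumeration rec
  nth′ : Fin (suc size) → ℕ
  nth′ zero    = B
  nth′ (suc x) = nth x
  injective′ : Injective _≡_ _≡_ nth′
  injective′ {zero}  {zero}  _  = refl
  injective′ {zero}  {suc y} eq = contradiction (sym eq) (<⇒≢ (nth< y))
  injective′ {suc x} {zero}  eq = contradiction eq (<⇒≢ (nth< x))
  injective′ {suc x} {suc y} eq = cong suc (injective eq)
  index′ : ∀ {i} → i < suc B → P i → ∃ λ x → nth′ x ≡ i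
  index′ i<1+B Pi with m<1+n⇒m<n∨m≡n i<1+B
  ... | inj₁ i<B  = Product.map suc id (index i<B Pi)
  ... | inj₂ refl = zero , refl

-- Least representatives

module Representatives (D : ℕ) .{{_ : NonZero D}}
  (In : Pred ℕ 0ℓ) (In-periodic : Periodic D D In)
  (E : Rel ℕ 0ℓ) (E-periodic : PeriodicRel D D E) where

  open PeriodicRel E-periodic

  Least : Pred ℕ 0ℓ
  Least i = In i × (∀ {j} → j < i → ¬ E j i)

  -- From 3D on, a representative j < i of i lies at least D below i or above 2D;
  -- in the latter case (i , j) can still be moved down by D along the diagonal.
  threshold : ℕ
  threshold = D + D + D

  Least-periodic : Periodic threshold D Least
  Least-periodic i T≤i = mk⇔
    (λ (In-i , least) → to (In-periodic i D≤i) In-i , up least)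
    (λ (In-i+D , least) → from (In-periodic i D≤i) In-i+D , down least)
    where
    D≤i : D ≤ i
    D≤i = ≤-trans (m≤n+m D (D + D)) T≤i

    near : ∀ {j} → ¬ (j + D ≤ i) → D + D ≤ j
    near j+D≰i = +-cancelʳ-≤ D _ _ (≤-trans T≤i (<⇒≤ (≰⇒> j+D≰i)))

    up : (∀ {j} → j < i → ¬ E j i) → ∀ {j} → j < i + D → ¬ E j (i + D)
    up least {j} j<i+D Eji with j + D ≤? i
    ... | yes j+D≤i = least (<-≤-trans (m<m+n j (>-nonZero⁻¹ D)) j+D≤i) (from (rightFar j i j+D≤i) Eji)
    -- Here `j` is at least 2D, so `o = j - D` is still at least `D`, as the diagonal shift
    -- requires, and it is a representative of `i` below `i`.
    ... | no  j+D≰i with o , refl ← m≤n⇒∃[o]m+o≡n (≤-trans (m≤m+n D D) (near j+D≰i)) =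
      least (+-cancelʳ-< D o i (subst (_< i + D) (+-comm D o) j<i+D))
        (from (diagonal o i (+-cancelˡ-≤ D D o (near j+D≰i)) D≤i) (subst (λ z → E z (i + D)) (+-comm D o) Eji))

    down : (∀ {j} → j < i + D → ¬ E j (i + D)) → ∀ {j} → j < i → ¬ E j i
    down least {j} j<i Eji with j + D ≤? i
    ... | yes j+D≤i = least (<-≤-trans j<i (m≤m+n i D)) (to (rightFar j i j+D≤i) Eji)
    ... | no  j+D≰i = least (+-monoˡ-< D j<i)
      (to (diagonal j i (≤-trans (m≤m+n D D) (near j+D≰i)) D≤i) Eji)

-- The foundational relation of a periodic relation

-- The cases follow the five disjuncts of `_ρ̂_` between elements of seeds.
data Position : ℕ → ℕ → Set where
  equal    : ∀ i → Position i i
  next     : ∀ i → Position i (suc i)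
  previous : ∀ i → Position (suc i) i
  after    : ∀ {i j} → 2 + i ≤ j → Position i j
  before   : ∀ {i j} → 2 + i ≤ j → Position j i

position : ∀ i j → Position i j
position zero          zero          = equal 0
position zero          1             = next 0
position zero          (suc (suc j)) = after (s≤s (s≤s z≤n))
position 1             zero          = previous 0
position (suc (suc i)) zero          = before (s≤s (s≤s z≤n))
position (suc i)       (suc j) with position i j
... | equal _    = equal (suc i)
... | next _     = next (suc i)
... | previous _ = previous (suc j)
... | after h    = after (s≤s h)
... | before h   = before (s≤s h)

-- `S i j` will relate the element `i` of one seed to the element `j` of another. Invariance along
-- the diagonal, together with constancy from distance 2 on, leaves only five values to be
-- specified.
module Uniform {S : Rel ℕ ℓ₁}
  (shift : ∀ i j → S i j ⇔ S (suc i) (suc j))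
  (farʳ : ∀ j → 2 ≤ j → S 0 j ⇔ S 0 (suc j))
  (farˡ : ∀ i → 2 ≤ i → S i 0 ⇔ S (suc i) 0) where

  same : ∀ i → S i i ⇔ S 0 0
  same zero    = ⇔-id _
  same (suc i) = ⇔-sym (shift i i) ⨾ same i

  up : ∀ i → S i (suc i) ⇔ S 0 1
  up zero    = ⇔-id _
  up (suc i) = ⇔-sym (shift i (suc i)) ⨾ up i

  down : ∀ i → S (suc i) i ⇔ S 1 0
  down zero    = ⇔-id _
  down (suc i) = ⇔-sym (shift (suc i) i) ⨾ down i

  farUp : ∀ i j → 2 + i ≤ j → S i j ⇔ S 0 2
  farUp (suc i) (suc j) 2+i≤j = ⇔-sym (shift i j) ⨾ farUp i j (s≤s⁻¹ 2+i≤j)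
  farUp zero    1       (s≤s ())
  farUp zero    2       _     = ⇔-id _
  farUp zero    (suc j@(suc (suc _))) _ = ⇔-sym (farʳ j (s≤s (s≤s z≤n))) ⨾ farUp zero j (s≤s (s≤s z≤n))

  farDown : ∀ i j → 2 + i ≤ j → S j i ⇔ S 2 0
  farDown (suc i) (suc j) 2+i≤j = ⇔-sym (shift j i) ⨾ farDown i j (s≤s⁻¹ 2+i≤j)
  farDown zero    1       (s≤s ())
  farDown zero    2       _     = ⇔-id _
  farDown zero    (suc j@(suc (suc _))) _ = ⇔-sym (farˡ j (s≤s (s≤s z≤n))) ⨾ farDown zero j (s≤s (s≤s z≤n))

  -- Written so as to agree by definition with `_ρ̂_` on two elements of seeds of the foundational
  -- relation `F` built from `point`.
  Propagated : Rel ℕ ℓ₁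
  Propagated i j =
      (j ≡ i × S 0 0) ⊎ (j ≡ suc i × S 0 1) ⊎ (i ≡ suc j × S 1 0)
    ⊎ (2 + i ≤ j × S 0 2) ⊎ (2 + j ≤ i × S 2 0)

  propagated : ∀ i j → Propagated i j ⇔ S i j
  propagated i j = mk⇔
    (λ { (inj₁ (refl , s)) → from (same i) s
       ; (inj₂ (inj₁ (refl , s))) → from (up i) s
       ; (inj₂ (inj₂ (inj₁ (refl , s)))) → from (down j) s
       ; (inj₂ (inj₂ (inj₂ (inj₁ (h , s))))) → from (farUp i j h) s
       ; (inj₂ (inj₂ (inj₂ (inj₂ (h , s))))) → from (farDown j i h) s })
    (classify (position i j))
    where
    classify : ∀ {i j} → Position i j → S i j → Propagated i j
    classify (equal i)    s = inj₁ (refl , to (same i) s)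
    classify (next i)     s = inj₂ (inj₁ (refl , to (up i) s))
    classify (previous i) s = inj₂ (inj₂ (inj₁ (refl , to (down i) s)))
    classify (after h)    s = inj₂ (inj₂ (inj₂ (inj₁ (h , to (farUp _ _ h) s))))
    classify (before h)   s = inj₂ (inj₂ (inj₂ (inj₂ (h , to (farDown _ _ h) s))))

-- Deciding the common value `A` once selects the alternative for the whole family.
allOrNone : {I : Set a} {A : Set ℓ₁} {P : Pred I ℓ} → Dec A → (∀ i → P i ⇔ A) → AllOrNone P
allOrNone (yes x) P⇔A = inj₁ λ i → from (P⇔A i) x
allOrNone (no ¬x) P⇔A = inj₂ λ i → ¬x ∘ to (P⇔A i)

module Foundation (D T : ℕ) .{{_ : NonZero D}} (D≤T : D ≤ T)
  (P : Pred ℕ 0ℓ) (P? : Decidable P) (P-periodic : Periodic T D P)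
  (R : Rel ℕ 0ℓ) (R? : ∀ i j → Dec (R i j)) (R-periodic : PeriodicRel D D R) where

  open PeriodicRel R-periodic
  module Initial = Enumeration (enumerate P? T)
  module Seeds   = Enumeration (enumerate (P? ∘ (T +_)) D)

  point : Fin Seeds.size → ℕ → ℕ
  point k i = T + Seeds.nth k + i * D

  point-suc : ∀ k i → point k (suc i) ≡ point k i + D
  point-suc k i = trans (cong (T + Seeds.nth k +_) (+-comm D (i * D))) (sym (+-assoc (T + Seeds.nth k) (i * D) D))

  T≤point : ∀ k i → T ≤ point k i
  T≤point k i = ≤-trans (m≤m+n T _) (m≤m+n _ (i * D))

  -- The offsets of two seeds differ by less than `D`. An index gap of 1 may thus leave the points
  -- closer than `D`, whereas a gap of 2 always suffices.
  point-far : ∀ k i l j → 2 + i ≤ j → point k i + D ≤ point l j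
  point-far k i l j 2+i≤j = begin
    T + Seeds.nth k + i * D + D ≤⟨ +-monoˡ-≤ D (+-monoˡ-≤ (i * D) (+-monoʳ-≤ T (<⇒≤ (Seeds.nth< k)))) ⟩
    T + D + i * D + D           ≡⟨ xy∙z≈xz∙y (T + D) (i * D) D ⟩
    T + D + D + i * D           ≡⟨ cong (_+ i * D) (+-assoc T D D) ⟩
    T + (D + D) + i * D         ≡⟨ +-assoc T (D + D) (i * D) ⟩
    T + (D + D + i * D)         ≡⟨ cong (T +_) (+-assoc D D (i * D)) ⟩
    T + (2 + i) * D             ≤⟨ +-mono-≤ (m≤m+n T (Seeds.nth l)) (*-monoˡ-≤ D 2+i≤j) ⟩
    T + Seeds.nth l + j * D     ∎
    where open ≤-Reasoning

  shift : ∀ k l i j → R (point k i) (point l j) ⇔ R (point k (suc i)) (point l (suc j))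
  shift k l i j =
    diagonal _ _ (≤-trans D≤T (T≤point k i)) (≤-trans D≤T (T≤point l j)) ⨾
    subst₂-⇔ R (sym (point-suc k i)) (sym (point-suc l j))

  module U k l = Uniform {S = λ i j → R (point k i) (point l j)} (shift k l)
    (λ j 2≤j → rightFar _ _ (point-far k 0 l j 2≤j) ⨾ subst-⇔ (R _) (sym (point-suc l j)))
    (λ i 2≤i → leftFar _ _ (point-far l 0 k i 2≤i) ⨾ subst-⇔ (λ z → R z (point l 0)) (sym (point-suc k i)))

  -- The first element of a seed can be closer than `D` to a point below `T`, the second cannot;
  -- this is why conditions 6 and 7 concern the elements from the second on.
  initial-far : ∀ x k i → Initial.nth x + D ≤ point k (suc i)
  initial-far x k i = subst (Initial.nth x + D ≤_) (sym (point-suc k i))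
    (+-monoˡ-≤ D (≤-trans (<⇒≤ (Initial.nth< x)) (T≤point k i)))

  initial-right : ∀ x k i → R (Initial.nth x) (point k (suc i)) ⇔ R (Initial.nth x) (point k 1)
  initial-right x k zero    = ⇔-id _
  initial-right x k (suc i) =
    subst-⇔ (R _) (point-suc k (suc i)) ⨾ ⇔-sym (rightFar _ _ (initial-far x k i)) ⨾ initial-right x k i

  initial-left : ∀ x k i → R (point k (suc i)) (Initial.nth x) ⇔ R (point k 1) (Initial.nth x)
  initial-left x k zero    = ⇔-id _
  initial-left x k (suc i) =
    subst-⇔ (λ z → R z (Initial.nth x)) (point-suc k (suc i)) ⨾ ⇔-sym (leftFar _ _ (initial-far x k i)) ⨾ initial-left x k i

  -- The propagated set with `Q′` replaced by the indices of the initial points, which avoids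
  -- carrying proofs of lying outside the seeds.
  Node : Set
  Node = Fin Initial.size ⊎ (Fin Seeds.size × ℕ)

  code : Node → ℕ
  code (inj₁ x)       = Initial.nth x
  code (inj₂ (k , i)) = point k i

  code-P : ∀ x → P (code x)
  code-P (inj₁ x)             = Initial.nth-P x
  code-P (inj₂ (k , zero))    = subst P (sym (+-identityʳ _)) (Seeds.nth-P k)
  code-P (inj₂ (k , (suc i))) =
    subst P (sym (point-suc k i)) (to (P-periodic (point k i) (T≤point k i)) (code-P (inj₂ (k , i))))

  offset : Fin Seeds.size → ℕ → ℕ
  offset k i = Seeds.nth k + i * D

  offset-% : ∀ k i → offset k i % D ≡ Seeds.nth k
  offset-% k i = trans ([m+kn]%n≡m%n (Seeds.nth k) i D) (m<n⇒m%n≡m (Seeds.nth< k))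

  -- Division by `D`: since `Seeds.nth k` is below `D`, it is the remainder and `i` the quotient.
  offset-injective : ∀ {k i l j} → offset k i ≡ offset l j → (k , i) ≡ (l , j)
  offset-injective {k} {i} {l} {j} eq
    with refl ← Seeds.injective {k} {l} (trans (sym (offset-% k i)) (trans (cong (_% D) eq) (offset-% l j))) =
    cong (k ,_) (*-cancelʳ-≡ i j D (+-cancelˡ-≡ (Seeds.nth k) _ _ eq))

  code-injective : Injective _≡_ _≡_ code
  code-injective {inj₁ x}       {inj₁ y}       eq = cong inj₁ (Initial.injective eq)
  code-injective {inj₁ x}       {inj₂ (l , j)} eq = contradiction eq (<⇒≢ (<-≤-trans (Initial.nth< x) (T≤point l j)))
  code-injective {inj₂ (k , i)} {inj₁ y}       eq = contradiction (sym eq) (<⇒≢ (<-≤-trans (Initial.nth< y) (T≤point k i)))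
  code-injective {inj₂ (k , i)} {inj₂ (l , j)} eq = cong inj₂ (offset-injective
    (+-cancelˡ-≡ T _ _ (trans (sym (+-assoc T _ _)) (trans eq (+-assoc T _ _)))))

  P-unshift : ∀ m i → T ≤ m → P (m + i * D) → P m
  P-unshift m zero    T≤m Pm = subst P (+-identityʳ m) Pm
  P-unshift m (suc i) T≤m Pm = P-unshift m i T≤m (from (P-periodic (m + i * D) (≤-trans T≤m (m≤m+n m _)))
    (subst P (trans (cong (m +_) (+-comm D (i * D))) (sym (+-assoc m (i * D) D))) Pm))

  code-surjective : ∀ {m} → P m → ∃ λ x → code x ≡ m
  code-surjective {m} Pm with T ≤? m
  ... | no  T≰m = Product.map inj₁ id (Initial.index (≰⇒> T≰m) Pm)
  ... | yes T≤m with o , refl ← m≤n⇒∃[o]m+o≡n T≤m =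
    -- With `o = m - T`, the remainder modulo `D` selects the seed and the quotient the position in
    -- it.
    let m≡ = trans (cong (T +_) (m≡m%n+[m/n]*n o D)) (sym (+-assoc T (o % D) (o / D * D)))
        k , k≡ = Seeds.index (m%n<n o D) (P-unshift (T + o % D) (o / D) (m≤m+n T _) (subst P m≡ Pm))
    in inj₂ (k , o / D) , trans (cong (λ z → T + z + o / D * D) k≡) (sym m≡)

  Base : Set
  Base = Fin Initial.size ⊎ (Fin Seeds.size × Fin 5)

  toNode : Base → Node
  toNode = Sum.map₂ (Product.map₂ toℕ)

  toNode-injective : Injective _≡_ _≡_ toNode
  toNode-injective {inj₁ x}       {inj₁ y}       eq = cong inj₁ (inj₁-injective eq)
  toNode-injective {inj₂ (k , i)} {inj₂ (l , j)} eq =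
    cong inj₂ (cong₂ _,_ (cong proj₁ (inj₂-injective eq)) (toℕ-injective (cong proj₂ (inj₂-injective eq))))

  F : FoundationalRelation
  F = record
    { Q            = Base
    ; Q-finite     = _ , ↔-sym +↔⊎ ↔-∘ (↔-id _ ⊎-↔ ↔-sym *↔×)
    ; _ρ_          = λ x y → R (code (toNode x)) (code (toNode y))
    ; n            = Seeds.size
    ; p            = λ k i → inj₂ (k , i)
    ; five-element = λ k eq → cong proj₂ (inj₂-injective eq)
    ; disjoint     = λ k l k≢l i j eq → k≢l (cong proj₁ (inj₂-injective eq))
    ; cond₁        = λ k l → allOrNone (R? _ _) λ i → U.same k l (toℕ i)
    ; cond₂        = λ k l → allOrNone (R? _ _) λ i →
                       subst-⇔ (λ z → R (point k z) (point l (suc (toℕ i)))) (toℕ-inject₁ i) ⨾ U.up k l (toℕ i)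
    ; cond₃        = λ k l → allOrNone (R? _ _) λ i →
                       subst-⇔ (λ z → R (point k (suc (toℕ i))) (point l z)) (toℕ-inject₁ i) ⨾ U.down k l (toℕ i)
    ; cond₄        = λ k l → allOrNone (R? _ _) λ ((i , j) , gap) → U.farUp k l _ _ gap
    ; cond₅        = λ k l → allOrNone (R? _ _) λ ((i , j) , gap) → U.farDown k l _ _ gap
    ; cond₆        = λ where
        k (inj₁ x , _)              → allOrNone (R? _ _) λ i → initial-right x k (toℕ i)
        k (inj₂ (l , j) , [ q≢p ])  → ⊥-elim-irr (q≢p l j refl)
    ; cond₇        = λ where
        k (inj₁ x , _)              → allOrNone (R? _ _) λ i → initial-left x k (toℕ i)
        k (inj₂ (l , j) , [ q≢p ])  → ⊥-elim-irr (q≢p l j refl)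
    }

  open Propagation F using (Q̂; _ρ̂_)

  propagatedNode : Q̂ → Node
  propagatedNode (inj₁ (inj₁ x , _))              = inj₁ x
  propagatedNode (inj₁ (inj₂ (l , j) , [ q≢p ]))  = ⊥-elim-irr (q≢p l j refl)
  propagatedNode (inj₂ (k , i))                   = inj₂ (k , i)

  propagatedNode-injective : Injective _≡_ _≡_ propagatedNode
  propagatedNode-injective {inj₁ (inj₁ x , _)} {inj₁ (inj₁ y , _)} eq =
    cong inj₁ (value-injective (cong inj₁ (inj₁-injective eq)))
  propagatedNode-injective {inj₂ _} {inj₂ _} eq = cong inj₂ (inj₂-injective eq)
  propagatedNode-injective {inj₁ (inj₂ (l , j) , [ q≢p ])} {_} _ = ⊥-elim-irr (q≢p l j refl)
  propagatedNode-injective {_} {inj₁ (inj₂ (l , j) , [ q≢p ])} _ = ⊥-elim-irr (q≢p l j refl)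

  propagatedNode-surjective : StrictlySurjective _≡_ propagatedNode
  propagatedNode-surjective (inj₁ x)       = inj₁ (inj₁ x , [ (λ _ _ ()) ]) , refl
  propagatedNode-surjective (inj₂ (k , i)) = inj₂ (k , i) , refl

  ρ̂⇔R : ∀ x y → x ρ̂ y ⇔ R (code (propagatedNode x)) (code (propagatedNode y))
  ρ̂⇔R (inj₁ (inj₁ x , _)) (inj₁ (inj₁ y , _))     = ⇔-id _
  ρ̂⇔R (inj₁ (inj₁ x , _)) (inj₂ (k , zero))       = ⇔-id _
  ρ̂⇔R (inj₁ (inj₁ x , _)) (inj₂ (k , suc i))      = ⇔-sym (initial-right x k i)
  ρ̂⇔R (inj₂ (k , zero))   (inj₁ (inj₁ y , _))     = ⇔-id _
  ρ̂⇔R (inj₂ (k , suc i))  (inj₁ (inj₁ y , _))     = ⇔-sym (initial-left y k i)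
  ρ̂⇔R (inj₂ (k , i))      (inj₂ (l , j))          = U.propagated k l i j
  ρ̂⇔R (inj₁ (inj₂ (l , j) , [ q≢p ])) _           = ⊥-elim-irr (q≢p l j refl)
  ρ̂⇔R _ (inj₁ (inj₂ (l , j) , [ q≢p ]))           = ⊥-elim-irr (q≢p l j refl)

-- Presentations give foundational relations

IsTournament-pullback : {A : Set a} {B : Set b} {_∼₁_ : Rel A ℓ₁} {_∼₂_ : Rel B ℓ₂} (f : A → B) →
                        Injective _≡_ _≡_ f → (∀ x y → x ∼₁ y ⇔ f x ∼₂ f y) →
                        IsTournament _∼₂_ → IsTournament _∼₁_
IsTournament-pullback f inj equiv tournament = record
  { irreflexive = λ x x∼x → irreflexive (f x) (to (equiv x x) x∼x)
  ; exactlyOne  = λ x y x≢y → Sum.map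
      (λ (xy , ¬yx) → from (equiv x y) xy , ¬yx ∘ to (equiv y x))
      (λ (¬xy , yx) → ¬xy ∘ to (equiv x y) , from (equiv y x) yx)
      (exactlyOne (f x) (f y) (x≢y ∘ inj))
  }
  where open IsTournament tournament

-- The isomorphism is the inverse of `f`, hence the exchanged order of the relations: the bijection
-- at hand goes from the propagated set to `X`.
bijection⇒Isomorphic : {A : Set a} {B : Set b} {_∼₁_ : Rel A ℓ₁} {_∼₂_ : Rel B ℓ₂} (f : A → B) →
                       Injective _≡_ _≡_ f → StrictlySurjective _≡_ f → (∀ x y → x ∼₁ y ⇔ f x ∼₂ f y) →
                       Isomorphic _∼₂_ _∼₁_
bijection⇒Isomorphic {_∼₁_ = _∼₁_} {_∼₂_} f inj surj equiv = f⁻¹ , record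
  { isOrderMonomorphism = record
    { isOrderHomomorphism = record
      { cong = cong f⁻¹
      ; mono = λ {x} {y} x∼y → from (equiv _ _) (subst₂ _∼₂_ (sym (f∘f⁻¹ x)) (sym (f∘f⁻¹ y)) x∼y)
      }
    ; injective = λ {x} {y} eq → trans (sym (f∘f⁻¹ x)) (trans (cong f eq) (f∘f⁻¹ y))
    ; cancel    = λ {x} {y} x∼y → subst₂ _∼₂_ (f∘f⁻¹ x) (f∘f⁻¹ y) (to (equiv _ _) x∼y)
    }
  ; surjective = λ y → f y , λ { refl → inj (f∘f⁻¹ (f y)) }
  }
  where
  f⁻¹    = λ x → proj₁ (surj x)
  f∘f⁻¹ = λ x → proj₂ (surj x)

-- X is numbered by In ⊆ ℕ, with E the kernel of the numbering and R the
-- preimage of the relation.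
module Numbering {X : Set c} {_⟶_ : Rel X ℓ} (D : ℕ) .{{_ : NonZero D}}
  (In : Pred ℕ 0ℓ) (In? : Decidable In) (In-periodic : Periodic D D In)
  (E : Rel ℕ 0ℓ) (E? : ∀ i j → Dec (E i j)) (E-periodic : PeriodicRel D D E)
  (R : Rel ℕ 0ℓ) (R? : ∀ i j → Dec (R i j)) (R-periodic : PeriodicRel D D R)
  (element : ∀ i → .(In i) → X)
  (element-surjective : ∀ x → ∃ λ i → Σ (In i) λ i∈ → element i i∈ ≡ x)
  (E⇒In : ∀ {i j} → E i j → In i)
  (≡⇔E : ∀ i j .(i∈ : In i) .(j∈ : In j) → element i i∈ ≡ element j j∈ ⇔ E i j)
  (⟶⇔R : ∀ i j .(i∈ : In i) .(j∈ : In j) → element i i∈ ⟶ element j j∈ ⇔ R i j)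
  where

  open Representatives D In In-periodic E E-periodic

  Least? : Decidable Least
  Least? i = In? i ×-dec allUpTo? (λ j → ¬? (E? j i)) i

  HasLeast : Pred ℕ _
  HasLeast i = (i∈ : In i) → ∃ λ j → Σ (Least j) λ least → element j (proj₁ least) ≡ element i i∈

  -- Descent: either some smaller `j` names the same element and the hypothesis applies to it, or
  -- `i` itself is least.
  hasLeast : ∀ i → HasLeast i
  hasLeast = <-rec HasLeast λ i rec → descend i rec (anyUpTo? (λ j → E? j i) i)
    where
    descend : ∀ i → (∀ {j} → j < i → HasLeast j) → Dec (∃ λ j → j < i × E j i) → HasLeast i
    descend i rec (yes (j , j<i , Eji)) i∈ =
      let k , least , eq = rec j<i (E⇒In Eji)
      in k , least , trans eq (from (≡⇔E j i (E⇒In Eji) i∈) Eji)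
    descend i rec (no none) i∈ = i , (i∈ , λ j<i Eji → none (_ , j<i , Eji)) , refl

  least-unique : ∀ {i j} (li : Least i) (lj : Least j) → element i (proj₁ li) ≡ element j (proj₁ lj) → i ≡ j
  least-unique {i} {j} (i∈ , least-i) (j∈ , least-j) eq with <-cmp i j
  ... | tri< i<j _ _ = contradiction (to (≡⇔E i j i∈ j∈) eq) (least-j i<j)
  ... | tri≈ _ i≡j _ = i≡j
  ... | tri> _ _ j<i = contradiction (to (≡⇔E j i j∈ i∈) (sym eq)) (least-i j<i)

  open Foundation D threshold (m≤n+m D (D + D)) Least Least? Least-periodic R R? R-periodic public

  nodeElement : Node → X
  nodeElement x = element (code x) (proj₁ (code-P x))

  nodeElement-injective : Injective _≡_ _≡_ nodeElement
  nodeElement-injective {x} {y} eq = code-injective (least-unique (code-P x) (code-P y) eq)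

  nodeElement-surjective : StrictlySurjective _≡_ nodeElement
  nodeElement-surjective x
    with i , i∈ , refl ← element-surjective x
    with j , least , eq ← hasLeast i i∈
    with y , refl ← code-surjective least
    = y , eq

  R⇔⟶ : ∀ x y → R (code x) (code y) ⇔ nodeElement x ⟶ nodeElement y
  R⇔⟶ x y = ⇔-sym (⟶⇔R (code x) (code y) (proj₁ (code-P x)) (proj₁ (code-P y)))

  -- Up to an injection, the relation of `F` is a restriction of `_⟶_`, and tournaments restrict to
  -- subsets.
  F-isTournament : IsTournament _⟶_ → IsTournament (FoundationalRelation._ρ_ F)
  F-isTournament = IsTournament-pullback (nodeElement ∘ toNode)
    (toNode-injective ∘ nodeElement-injective) (λ x y → R⇔⟶ (toNode x) (toNode y))

  F-isomorphic : Isomorphic _⟶_ (Propagation._ρ̂_ F)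
  F-isomorphic = bijection⇒Isomorphic (nodeElement ∘ propagatedNode)
    (propagatedNode-injective ∘ nodeElement-injective)
    (λ x → let y , eq  = nodeElement-surjective x
               z , eq′ = propagatedNode-surjective y
           in z , trans (cong nodeElement eq′) eq)
    (λ x y → ρ̂⇔R x y ⨾ R⇔⟶ (propagatedNode x) (propagatedNode y))

-- Recovering words from their convolution

mapMaybe-proj₁-conv : {A : Set a} (u v : List A) → mapMaybe proj₁ (conv u v) ≡ u
mapMaybe-proj₁-conv []      []      = refl
mapMaybe-proj₁-conv []      (y ∷ v) = mapMaybe-proj₁-conv [] v
mapMaybe-proj₁-conv (x ∷ u) []      = cong (x ∷_) (trans (cong (mapMaybe proj₁) (sym (conv-[] u))) (mapMaybe-proj₁-conv u []))
mapMaybe-proj₁-conv (x ∷ u) (y ∷ v) = cong (x ∷_) (mapMaybe-proj₁-conv u v)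

mapMaybe-proj₂-conv : {A : Set a} (u v : List A) → mapMaybe proj₂ (conv u v) ≡ v
mapMaybe-proj₂-conv []      []      = refl
mapMaybe-proj₂-conv []      (y ∷ v) = cong (y ∷_) (mapMaybe-proj₂-conv [] v)
mapMaybe-proj₂-conv (x ∷ u) []      = trans (cong (mapMaybe proj₂) (sym (conv-[] u))) (mapMaybe-proj₂-conv u [])
mapMaybe-proj₂-conv (x ∷ u) (y ∷ v) = cong (y ∷_) (mapMaybe-proj₂-conv u v)

conv-injective : {A : Set a} {u v u′ v′ : List A} → conv u v ≡ conv u′ v′ → u ≡ u′ × v ≡ v′
conv-injective {u = u} {v} {u′} {v′} eq =
  trans (sym (mapMaybe-proj₁-conv u v)) (trans (cong (mapMaybe proj₁) eq) (mapMaybe-proj₁-conv u′ v′)) ,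
  trans (sym (mapMaybe-proj₂-conv u v)) (trans (cong (mapMaybe proj₂) eq) (mapMaybe-proj₂-conv u′ v′))

a^-length : (u : List ⊤) → a^ length u ≡ u
a^-length []      = refl
a^-length (_ ∷ u) = cong (_ ∷_) (a^-length u)

presentable⇒foundational : {X : Set c} {_⟶_ : Rel X ℓ} → IsTournament _⟶_ → UnaryFAPresentable _⟶_ →
  Σ FoundationalRelation λ F → IsTournament (FoundationalRelation._ρ_ F) × Isomorphic _⟶_ (Propagation._ρ̂_ F)
presentable⇒foundational {X = X} {_⟶_} tournament presentation = N.F , N.F-isTournament tournament , N.F-isomorphic
  where
  open UnaryFAPresentable presentation
  open DFA using (Accepts; states; final)
  module φ = Surjection φ

  M-L : DFA ⊤
  M-L = proj₁ L-regular

  M-≡ M-⟶ : DFA Letter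
  M-≡ = proj₁ ≡-regular
  M-⟶ = proj₁ ⟶-regular

  -- One bound for the state counts of all three automata makes `K !` a common period.
  K : ℕ
  K = states M-L + (states M-≡ + states M-⟶)

  In : Pred ℕ 0ℓ
  In i = Accepts M-L (a^ i)

  In? : Decidable In
  In? i = _ ∈? final M-L

  element : ∀ i → .(In i) → X
  element i i∈ = φ.to (a^ i , [ from (proj₂ L-regular (a^ i)) i∈ ])

  element-surjective : ∀ x → ∃ λ i → Σ (In i) λ i∈ → element i i∈ ≡ x
  element-surjective x with (u , [ u∈ ]) , φu≡x ← φ.strictlySurjective x =
    length u ,
    -- The refinement holds its membership proof irrelevantly; deciding acceptance gives a usable
    -- one.
    recompute (In? (length u)) (to (proj₂ L-regular _) (subst L (sym (a^-length u)) u∈)) ,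
    trans (cong φ.to (value-injective (a^-length u))) φu≡x

  accepts⇒pair : (S : Rel X ℓ₁) (reg : Regular (Pairs S)) → ∀ i j → Accepts (proj₁ reg) (conv (a^ i) (a^ j)) →
                 ∃₂ λ u v → value u ≡ a^ i × value v ≡ a^ j × S (φ.to u) (φ.to v)
  accepts⇒pair S reg i j acc with from (proj₂ reg _) acc
  ... | u , v , eq , s with eq₁ , eq₂ ← conv-injective {u = a^ i} {v = a^ j} eq = u , v , sym eq₁ , sym eq₂ , s

  -- By injectivity of `conv` an accepted word comes from `a^ i` and `a^ j` themselves, and `φ` does
  -- not depend on the membership proofs.
  related⇔accepts : (S : Rel X ℓ₁) (reg : Regular (Pairs S)) → ∀ i j .(i∈ : In i) .(j∈ : In j) →
                    S (element i i∈) (element j j∈) ⇔ Accepts (proj₁ reg) (conv (a^ i) (a^ j))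
  related⇔accepts S reg i j i∈ j∈ = mk⇔
    (λ s → to (proj₂ reg _) (_ , _ , refl , s))
    (λ acc → let u , v , eq₁ , eq₂ , s = accepts⇒pair S reg i j acc in
      subst₂ S (cong φ.to (value-injective eq₁)) (cong φ.to (value-injective eq₂)) s)

  E⇒In : ∀ {i j} → Accepts M-≡ (conv (a^ i) (a^ j)) → In i
  E⇒In {i} {j} Eij with accepts⇒pair _≡_ ≡-regular i j Eij
  ... | (_ , [ u∈ ]) , _ , refl , _ = recompute (In? i) (to (proj₂ L-regular (a^ i)) u∈)

  module N = Numbering {_⟶_ = _⟶_} (K !) {{K !≢0}}
    In In? (accepts-periodic M-L {K} (m≤m+n _ _))
    _ (λ i j → _ ∈? final M-≡)
    (accepts-conv-periodic M-≡ {K} (≤-trans (m≤m+n _ _) (m≤n+m _ (states M-L))))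
    _ (λ i j → _ ∈? final M-⟶)
    (accepts-conv-periodic M-⟶ {K} (≤-trans (m≤n+m _ (states M-≡)) (m≤n+m _ (states M-L))))
    element element-surjective (λ {i} → E⇒In {i})
    (related⇔accepts _≡_ ≡-regular) (related⇔accepts _⟶_ ⟶-regular)

-- Propagations are presentable

-- The disjunction in `exactlyOne` carries the answer for distinct elements, and irreflexivity
-- settles equal ones.
IsTournament⇒decidable : {A : Set a} {_∼_ : Rel A ℓ} → DecidableEquality A → IsTournament _∼_ → B.Decidable _∼_
IsTournament⇒decidable _≟′_ tournament x y with x ≟′ y
... | yes refl = no (IsTournament.irreflexive tournament x)
... | no x≢y with IsTournament.exactlyOne tournament x y x≢y
...   | inj₁ (xy , _)  = yes xy
...   | inj₂ (¬xy , _) = no ¬xy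

fromJust : {A : Set a} (m : Maybe A) → .(T (is-just m)) → A
fromJust (just x) _ = x

Both : {A : Set a} → Rel A 0ℓ → Rel (Maybe A) 0ℓ
Both S (just x) (just y) = S x y
Both S _        _        = ⊥

both? : {A : Set a} {S : Rel A 0ℓ} → B.Decidable S → B.Decidable (Both S)
both? S? (just x) (just y) = S? x y
both? S? (just x) nothing  = no id
both? S? nothing  _        = no id

fromJust-both : {A : Set a} (S : Rel A 0ℓ) (m m′ : Maybe A) .(t : T (is-just m)) .(t′ : T (is-just m′)) →
                S (fromJust m t) (fromJust m′ t′) ≡ Both S m m′
fromJust-both S (just _) (just _) _ _ = refl

both⇒is-just : {A : Set a} (S : Rel A 0ℓ) (m m′ : Maybe A) → Both S m m′ → T (is-just m) × T (is-just m′)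
both⇒is-just S (just _) (just _) _ = tt , tt

-- Division of lengths into blocks

module Blocks (M : ℕ) .{{_ : NonZero M}} where

  [m+M]/M : ∀ m → (m + M) / M ≡ suc (m / M)
  [m+M]/M m = trans (+-distrib-/-∣ʳ m ∣-refl) (trans (cong (m / M +_) (n/n≡1 M)) (+-comm (m / M) 1))

  mod-cong : ∀ {m n} → m % M ≡ n % M → m mod M ≡ n mod M
  mod-cong {m} {n} eq = toℕ-injective (trans (toℕ-fromℕ< (m%n<n m M)) (trans eq (sym (toℕ-fromℕ< (m%n<n n M)))))

  [r+iM]-mod : ∀ (r : Fin M) i → (toℕ r + i * M) mod M ≡ r
  [r+iM]-mod r i = toℕ-injective (trans (toℕ-fromℕ< (m%n<n (toℕ r + i * M) M))
    (trans ([m+kn]%n≡m%n (toℕ r) i M) (m<n⇒m%n≡m (toℕ<n r))))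

  [r+iM]/M : ∀ (r : Fin M) i → (toℕ r + i * M) / M ≡ i
  [r+iM]/M r i = trans (+-distrib-/-∣ʳ (toℕ r) (divides-refl i))
    (cong₂ _+_ (m<n⇒m/n≡0 (toℕ<n r)) (m*n/n≡m i M))

  two-blocks-apart : ∀ {m n} → m + (M + M) ≤ n → 2 + m / M ≤ n / M
  two-blocks-apart {m} {n} h = subst (_≤ n / M)
    (trans ([m+M]/M (m + M)) (cong suc ([m+M]/M m)))
    (/-monoˡ-≤ M (subst (_≤ n) (sym (+-assoc m M M)) h))

module FromFoundation (F : FoundationalRelation) (tournament : IsTournament (FoundationalRelation._ρ_ F)) where

  open FoundationalRelation F
  open Propagation F

  private
    m : ℕ
    m = proj₁ Q-finite
    module Q = Inverse (proj₂ Q-finite)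

  _≟Q_ : DecidableEquality Q
  _≟Q_ = Fin.inj⇒≟ (↔⇒↣ (proj₂ Q-finite))

  _ρ?_ : B.Decidable _ρ_
  _ρ?_ = IsTournament⇒decidable _≟Q_ tournament

  _≟Q̂_ : DecidableEquality Q̂
  _≟Q̂_ = Sum.≡-dec (Refinement._≟_ _≟Q_) (Product.≡-dec Fin._≟_ _≟_)

  _ρ̂?_ : B.Decidable _ρ̂_
  inj₁ q           ρ̂? inj₁ r           = value q ρ? value r
  inj₂ (k , i)     ρ̂? inj₂ (l , j)     =
           (j ≟ i        ×-dec (_ ρ? _))
    ⊎-dec ((j ≟ suc i    ×-dec (_ ρ? _))
    ⊎-dec ((i ≟ suc j    ×-dec (_ ρ? _))
    ⊎-dec ((2 + i ≤? j   ×-dec (_ ρ? _))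
    ⊎-dec  (2 + j ≤? i   ×-dec (_ ρ? _)))))
  inj₁ q           ρ̂? inj₂ (k , zero)  = _ ρ? _
  inj₁ q           ρ̂? inj₂ (k , suc _) = _ ρ? _
  inj₂ (k , zero)  ρ̂? inj₁ q           = _ ρ? _
  inj₂ (k , suc _) ρ̂? inj₁ q           = _ ρ? _

  -- A seed counts as one class, the position in it being supplied by the block number. Its five
  -- residues thus represent the same element in each block, which is harmless because `φ` may
  -- repeat values.
  Class : Set
  Class = Q′ ⊎ Fin n

  place : ℕ → Class → Q̂
  place i (inj₁ q) = inj₁ q
  place i (inj₂ k) = inj₂ (k , i)

  seed? : ∀ q → Dec (∃₂ λ k i → q ≡ p k i)
  seed? q = any? λ k → any? λ i → q ≟Q p k i

  classify : Q → Class
  classify q with seed? q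
  ... | yes (k , _)  = inj₂ k
  ... | no  not-seed = inj₁ (q , [ (λ k i q≡p → not-seed (k , i , q≡p)) ])

  classify-surjective : StrictlySurjective _≡_ classify
  classify-surjective (inj₁ (q , [ q≢p ])) = q , initial
    where
    initial : classify q ≡ inj₁ (q , [ q≢p ])
    initial with seed? q
    ... | yes (k , i , q≡p) = ⊥-elim-irr (q≢p k i q≡p)
    ... | no  _             = refl
  classify-surjective (inj₂ k) = p k zero , seed
    where
    seed : classify (p k zero) ≡ inj₂ k
    seed with seed? (p k zero)
    ... | no  not-seed    = contradiction (k , zero , refl) not-seed
    -- The search may return any seed and position that fit; disjointness forces the seed to be `k`.
    ... | yes (l , i , eq) with k Fin.≟ l
    ...   | yes refl = refl
    ...   | no  k≢l  = contradiction eq (disjoint k l k≢l zero i)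

  -- Residue 0 represents nothing, so that there is a block also when Q is empty.
  M : ℕ
  M = suc m

  open Blocks M

  residueClass : Fin M → Maybe Class
  residueClass zero    = nothing
  residueClass (suc r) = just (classify (Q.from r))

  class : ℕ → Maybe Class
  class t = residueClass (t mod M)

  represent : ℕ → Maybe Q̂
  represent t = Maybe.map (place (t / M)) (class t)

  represent-surjective : ∀ x → ∃ λ t → represent t ≡ just x
  represent-surjective x = toℕ r + i * M , trans
    (cong₂ (λ i′ r′ → Maybe.map (place i′) (residueClass r′)) ([r+iM]/M r i) ([r+iM]-mod r i))
    (cong just (trans (cong (place i ∘ classify) (Q.strictlyInverseʳ q)) (trans (cong (place i) (proj₂ (classify-surjective u))) place-u)))
    where
    split : ∀ x → ∃₂ λ i u → place i u ≡ x
    -- An element of `Q′` is represented in every block; block 0 is chosen.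
    split (inj₁ q)       = 0 , inj₁ q , refl
    split (inj₂ (k , i)) = i , inj₂ k , refl
    i = proj₁ (split x)
    u = proj₁ (proj₂ (split x))
    place-u = proj₂ (proj₂ (split x))
    q = proj₁ (classify-surjective u)
    r : Fin M
    r = suc (Q.to q)

  -- The common ground of equality and `_ρ̂_`. Block 0 is excluded from `shift` because the first
  -- element of a seed may relate to `Q′` differently from the later ones.
  record Invariant (S : Rel Q̂ 0ℓ) : Set where
    field
      shift : ∀ u v i j → 1 ≤ i → 1 ≤ j → S (place i u) (place j v) ⇔ S (place (suc i) u) (place (suc j) v)
      right : ∀ u v i j → 2 + i ≤ j → S (place i u) (place j v) ⇔ S (place i u) (place (suc j) v)
      left  : ∀ u v i j → 2 + j ≤ i → S (place i u) (place j v) ⇔ S (place (suc i) u) (place j v)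

  ≡-invariant : Invariant _≡_
  ≡-invariant = record { shift = shift ; right = right ; left = left }
    where
    shift : ∀ u v i j → 1 ≤ i → 1 ≤ j → place i u ≡ place j v ⇔ place (suc i) u ≡ place (suc j) v
    shift (inj₁ _) (inj₁ _) i j _ _ = ⇔-id _
    shift (inj₁ _) (inj₂ _) i j _ _ = mk⇔ (λ ()) (λ ())
    shift (inj₂ _) (inj₁ _) i j _ _ = mk⇔ (λ ()) (λ ())
    shift (inj₂ _) (inj₂ _) i j _ _ = mk⇔ (λ { refl → refl }) (λ { refl → refl })
    right : ∀ u v i j → 2 + i ≤ j → place i u ≡ place j v ⇔ place i u ≡ place (suc j) v
    right (inj₁ _) (inj₁ _) i j _ = ⇔-id _
    right (inj₁ _) (inj₂ _) i j _ = mk⇔ (λ ()) (λ ())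
    right (inj₂ _) (inj₁ _) i j _ = mk⇔ (λ ()) (λ ())
    right (inj₂ _) (inj₂ _) i j 2+i≤j = mk⇔
      (λ { refl → contradiction 2+i≤j (<⇒≱ (m≤n⇒m≤1+n ≤-refl)) })
      (λ { refl → contradiction 2+i≤j (<⇒≱ (m≤n⇒m≤1+n (m≤n⇒m≤1+n ≤-refl))) })
    left : ∀ u v i j → 2 + j ≤ i → place i u ≡ place j v ⇔ place (suc i) u ≡ place j v
    left u v i j 2+j≤i = mk⇔ sym sym ⨾ right v u j i 2+j≤i ⨾ mk⇔ sym sym

  ρ̂-invariant : Invariant _ρ̂_
  ρ̂-invariant = record { shift = shift ; right = right ; left = left }
    where
    shift : ∀ u v i j → 1 ≤ i → 1 ≤ j → place i u ρ̂ place j v ⇔ place (suc i) u ρ̂ place (suc j) v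
    shift (inj₁ _) (inj₁ _) i       j       _ _ = ⇔-id _
    shift (inj₁ _) (inj₂ _) i       (suc j) _ _ = ⇔-id _
    shift (inj₂ _) (inj₁ _) (suc i) j       _ _ = ⇔-id _
    shift (inj₂ _) (inj₂ _) i       j       _ _ = mk⇔
      (Sum.map (Product.map₁ (cong suc)) (Sum.map (Product.map₁ (cong suc)) (Sum.map (Product.map₁ (cong suc))
        (Sum.map (Product.map₁ s≤s) (Product.map₁ s≤s)))))
      (Sum.map (Product.map₁ suc-injective) (Sum.map (Product.map₁ suc-injective) (Sum.map (Product.map₁ suc-injective)
        (Sum.map (Product.map₁ s≤s⁻¹) (Product.map₁ s≤s⁻¹)))))
    -- An index gap of 2 rules out every disjunct of `_ρ̂_` but the fourth.
    far-right : ∀ k l i j → 2 + i ≤ j → inj₂ (k , i) ρ̂ inj₂ (l , j) ⇔ p k zero ρ p l (suc (suc zero))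
    far-right k l i j 2+i≤j = mk⇔
      (λ { (inj₁ (refl , _)) → contradiction 2+i≤j (<⇒≱ (m≤n⇒m≤1+n ≤-refl))
         ; (inj₂ (inj₁ (refl , _))) → contradiction 2+i≤j (<⇒≱ ≤-refl)
         ; (inj₂ (inj₂ (inj₁ (refl , _)))) → contradiction 2+i≤j (<⇒≱ (m≤n⇒m≤1+n (m≤n⇒m≤1+n ≤-refl)))
         ; (inj₂ (inj₂ (inj₂ (inj₁ (_ , s))))) → s
         ; (inj₂ (inj₂ (inj₂ (inj₂ (2+j≤i , _))))) →
             contradiction (≤-trans (m≤n+m _ 2) (≤-trans 2+j≤i (m≤n+m i 1))) (<⇒≱ 2+i≤j) })
      (λ s → inj₂ (inj₂ (inj₂ (inj₁ (2+i≤j , s)))))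
    far-left : ∀ k l i j → 2 + j ≤ i → inj₂ (k , i) ρ̂ inj₂ (l , j) ⇔ p k (suc (suc zero)) ρ p l zero
    far-left k l i j 2+j≤i = mk⇔
      (λ { (inj₁ (refl , _)) → contradiction 2+j≤i (<⇒≱ (m≤n⇒m≤1+n ≤-refl))
         ; (inj₂ (inj₁ (refl , _))) → contradiction 2+j≤i (<⇒≱ (m≤n⇒m≤1+n (m≤n⇒m≤1+n ≤-refl)))
         ; (inj₂ (inj₂ (inj₁ (refl , _)))) → contradiction 2+j≤i (<⇒≱ ≤-refl)
         ; (inj₂ (inj₂ (inj₂ (inj₁ (2+i≤j , _))))) →
             contradiction (≤-trans (m≤n+m _ 2) (≤-trans 2+i≤j (m≤n+m j 1))) (<⇒≱ 2+j≤i)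
         ; (inj₂ (inj₂ (inj₂ (inj₂ (_ , s))))) → s })
      (λ s → inj₂ (inj₂ (inj₂ (inj₂ (2+j≤i , s)))))
    right : ∀ u v i j → 2 + i ≤ j → place i u ρ̂ place j v ⇔ place i u ρ̂ place (suc j) v
    right (inj₁ _) (inj₁ _) i       j       _ = ⇔-id _
    right (inj₁ _) (inj₂ _) i       (suc j) _ = ⇔-id _
    right (inj₂ _) (inj₁ _) i       j       _ = ⇔-id _
    right (inj₂ k) (inj₂ l) i       j       2+i≤j =
      far-right k l i j 2+i≤j ⨾ ⇔-sym (far-right k l i (suc j) (m≤n⇒m≤1+n 2+i≤j))
    left : ∀ u v i j → 2 + j ≤ i → place i u ρ̂ place j v ⇔ place (suc i) u ρ̂ place j v
    left (inj₁ _) (inj₁ _) i       j       _ = ⇔-id _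
    left (inj₁ _) (inj₂ _) i       j       _ = ⇔-id _
    left (inj₂ _) (inj₁ _) (suc i) j       _ = ⇔-id _
    left (inj₂ k) (inj₂ l) i       j       2+j≤i =
      far-left k l i j 2+j≤i ⨾ ⇔-sym (far-left k l (suc i) j (m≤n⇒m≤1+n 2+j≤i))

  represent-+ : ∀ t → represent (t + M) ≡ Maybe.map (place (suc (t / M))) (class t)
  represent-+ t = cong₂ (λ i r → Maybe.map (place i) (residueClass r)) ([m+M]/M t) (mod-cong {t + M} {t} ([m+n]%n≡m%n t M))

  module _ {S : Rel Q̂ 0ℓ} where

    both-map : ∀ {i j i′ j′} → (∀ u v → S (place i u) (place j v) ⇔ S (place i′ u) (place j′ v)) →
               ∀ u v → Both S (Maybe.map (place i) u) (Maybe.map (place j) v) ⇔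
                       Both S (Maybe.map (place i′) u) (Maybe.map (place j′) v)
    both-map equiv (just u) (just v) = equiv u v
    both-map equiv (just u) nothing  = ⇔-id _
    both-map equiv nothing  _        = ⇔-id _

    -- Adding `M` to a length keeps its residue and moves it to the next block. The threshold 2M
    -- places both lengths beyond block 0 for the diagonal, and makes a distance of 2M a gap of at
    -- least two blocks for the far shifts.
    invariant⇒periodic : Invariant S → PeriodicRel (M + M) M (λ s t → Both S (represent s) (represent t))
    invariant⇒periodic invariant = record
      { diagonal = λ s t h h′ →
          both-map (λ u v → shift u v (s / M) (t / M) (positive h) (positive h′)) (class s) (class t) ⨾
          subst₂-⇔ (Both S) (sym (represent-+ s)) (sym (represent-+ t))
      ; rightFar = λ s t h →
          both-map (λ u v → right u v (s / M) (t / M) (two-blocks-apart h)) (class s) (class t) ⨾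
          subst-⇔ (Both S (represent s)) (sym (represent-+ t))
      ; leftFar = λ s t h →
          both-map (λ u v → left u v (s / M) (t / M) (two-blocks-apart h)) (class s) (class t) ⨾
          subst-⇔ (λ z → Both S z (represent t)) (sym (represent-+ s))
      }
      where
      open Invariant invariant
      positive : ∀ {t} → M + M ≤ t → 1 ≤ t / M
      positive h = m≥n⇒m/n>0 (≤-trans (m≤m+n M M) h)

  Represents : Pred ℕ 0ℓ
  Represents t = T (is-just (represent t))

  represents-periodic : Periodic 0 M Represents
  represents-periodic t _ = subst-⇔ T (trans (is-just-map (class t))
    (cong is-just (sym (represent-+ t))))
    where
    is-just-map : ∀ {i j} u → is-just (Maybe.map (place i) u) ≡ is-just (Maybe.map (place j) u)
    is-just-map (just _) = refl
    is-just-map nothing  = refl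

  module _ {X : Set c} {_⟶_ : Rel X ℓ} (iso : Isomorphic _⟶_ _ρ̂_) where

    private
      f : X → Q̂
      f = proj₁ iso
      module f = IsOrderIsomorphism (proj₂ iso)

      f⁻¹ : Q̂ → X
      f⁻¹ x = proj₁ (f.surjective x)

      f∘f⁻¹ : ∀ x → f (f⁻¹ x) ≡ x
      f∘f⁻¹ x = proj₂ (f.surjective x) refl

      L : Pred (List ⊤) 0ℓ
      L = Represents ∘ length

      node : Refinement (List ⊤) L → Q̂
      node (u , [ u∈ ]) = fromJust (represent (length u)) u∈

      node-surjective : StrictlySurjective _≡_ node
      node-surjective x with t , eq ← represent-surjective x =
        (a^ t , [ subst (T ∘ is-just) (sym eq′) tt ]) , fromJust-≡ _ _ eq′
        where
        eq′ : represent (length (a^ t)) ≡ just x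
        eq′ = trans (cong represent (length-replicate t)) eq
        fromJust-≡ : ∀ m .(h : T (is-just m)) → m ≡ just x → fromJust m h ≡ x
        fromJust-≡ _ _ refl = refl

      -- Words are exchanged for their lengths; membership of both words in `L` is absorbed by
      -- `Both`, which is false where `represent` is undefined.
      pairs⇔ : (S : Rel X ℓ₁) (S′ : Rel Q̂ 0ℓ) → (∀ x y → S (f⁻¹ x) (f⁻¹ y) ⇔ S′ x y) → ∀ w →
        (∃₂ λ u v → w ≡ conv (value u) (value v) × S (f⁻¹ (node u)) (f⁻¹ (node v))) ⇔
        ConvLanguage (λ s t → Both S′ (represent s) (represent t)) w
      pairs⇔ S S′ equiv w = mk⇔
        (λ { ((u , [ u∈ ]) , (v , [ v∈ ]) , refl , s) →
             length u , length v , cong₂ conv (sym (a^-length u)) (sym (a^-length v)) ,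
             subst id (fromJust-both S′ (represent (length u)) (represent (length v)) u∈ v∈) (to (equiv _ _) s) })
        (λ { (s , t , refl , h) → back s t h })
        where
        back : ∀ s t → Both S′ (represent s) (represent t) →
               ∃₂ λ u v → conv (a^ s) (a^ t) ≡ conv (value u) (value v) × S (f⁻¹ (node u)) (f⁻¹ (node v))
        back s t h =
          let h′ = subst₂ (λ i j → Both S′ (represent i) (represent j)) (sym (length-replicate s)) (sym (length-replicate t)) h
              s∈ , t∈ = both⇒is-just S′ (represent (length (a^ s))) (represent (length (a^ t))) h′
          in (a^ s , [ s∈ ]) , (a^ t , [ t∈ ]) , refl ,
             from (equiv _ _) (subst id (sym (fromJust-both S′ (represent (length (a^ s))) (represent (length (a^ t))) s∈ t∈)) h′)

      regular-pairs : (S : Rel X ℓ₁) (S′ : Rel Q̂ 0ℓ) → (∀ x y → S (f⁻¹ x) (f⁻¹ y) ⇔ S′ x y) →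
        B.Decidable S′ → Invariant S′ →
        Regular (λ w → ∃₂ λ u v → w ≡ conv (value u) (value v) × S (f⁻¹ (node u)) (f⁻¹ (node v)))
      regular-pairs S S′ equiv S′? invariant =
        let A , A⇔ = periodicRel⇒regular (M + M) M (λ s t → both? S′? (represent s) (represent t)) (invariant⇒periodic invariant)
        in A , λ w → pairs⇔ S S′ equiv w ⨾ A⇔ w

    presentable : UnaryFAPresentable _⟶_
    presentable = record
      { L         = L
      ; L-regular = periodic⇒regular 0 M (λ t → T? _) represents-periodic
      ; φ         = mk↠ₛ {to = f⁻¹ ∘ node} λ x →
          let u , eq = node-surjective (f x) in u , f.injective (trans (f∘f⁻¹ (node u)) eq)
      ; ≡-regular = regular-pairs _≡_ _≡_
          (λ x y → mk⇔ (λ eq → trans (sym (f∘f⁻¹ x)) (trans (cong f eq) (f∘f⁻¹ y))) (cong f⁻¹)) _≟Q̂_ ≡-invariant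
      ; ⟶-regular = regular-pairs _⟶_ _ρ̂_
          (λ x y → mk⇔
            (λ s → subst₂ _ρ̂_ (f∘f⁻¹ x) (f∘f⁻¹ y) (f.mono s))
            (λ s → f.cancel (subst₂ _ρ̂_ (sym (f∘f⁻¹ x)) (sym (f∘f⁻¹ y)) s))) _ρ̂?_ ρ̂-invariant
      }

theorem5p12 : ∀ {c ℓ} {X : Set c} (_⟶_ : Rel X ℓ) → IsTournament _⟶_ →
    UnaryFAPresentable _⟶_ ⇔
    Σ FoundationalRelation (λ F →
    IsTournament (FoundationalRelation._ρ_ F) ×
    Isomorphic _⟶_ (Propagation._ρ̂_ F))
theorem5p12 _⟶_ tournament = mk⇔
  (presentable⇒foundational tournament)
  (λ (F , F-tournament , iso) → FromFoundation.presentable F F-tournament iso)
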